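{- Let $D$ be a finite, simple, connected (unweighted) digraph with vertex set $V(D)=\{v_1,\dots,v_n\}$, and let $M(D)$ be its middle digraph. Then $$t(M(D))=t(D)\prod_{i=1}^{n}(1+d_i)^{r_i},$$ where $t(\cdot)$ denotes the number of spanning trees of a digraph (over all possible roots), $d_i=d_+(v_i)$ is the number of arcs of $D$ with tail $v_i$, and $r_i=d_-(v_i)$ is the number of arcs of $D$ with head $v_i$.
   Context: Digraphs are finite and simple (no loops, no parallel arcs; opposite arcs $(u,v)$ and $(v,u)$ may both be present). Connected means that the underlying undirected graph is connected. For an arc $e=(u,v)$, $t(e)=u$ is its tail and $h(e)=v$ its head. Spanning tree: a spanning tree of a digraph $D$ is a connected subdigraph containing all vertices of $D$ and having no cycles, in which one vertex (the root) has outdegree $0$ and every other vertex has outdegree $1$ (so arcs point towards the root). Middle digraph: $M(D)$ is the digraph with vertex set $V(D)\cup A(D)$ (disjoint union of the vertex set and the arc set of $D$) whose arcs are: $(v,e)$ for $v\in V(D)$, $e\in A(D)$ with $t(e)=v$; $(e,v)$ for $e\in A(D)$, $v\in V(D)$ with $h(e)=v$; and $(e,f)$ for $e,f\in A(D)$ with $h(e)=t(f)$. -}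

module Defs where

open import Axiom.UniquenessOfIdentityProofs using (module Decidable⇒UIP)
open import Data.Fin.Base using (Fin)
import Data.Fin.Properties as Fin
open import Data.Fin.Subset using (Subset; _∈_; inside; outside)
open import Data.Fin.Subset.Properties using (_∈?_)
open import Data.List.Base
  using (List; []; _∷_; _++_; map; filter; length; lookup; cartesianProduct)
import Data.List.Membership.Propositional as List
open import Data.List.Membership.Propositional using (lose; find)
open import Data.List.Membership.Propositional.Properties
  using (∈-++⁺ˡ; ∈-++⁺ʳ; ∈-map⁺; ∈-map⁻; ∈-cartesianProduct⁺)
open import Data.List.Relation.Unary.All as All using (All; []; _∷_)
open import Data.List.Relation.Unary.AllPairs using ([]; _∷_)
open import Data.List.Relation.Unary.Any as Any using (here; there; index)
open import Data.List.Relation.Unary.Any.Properties using (lookup-index)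
open import Data.List.Relation.Unary.Unique.Propositional using (Unique)
import Data.List.Relation.Unary.Unique.Propositional.Properties as Unique
open import Data.Nat.Base using (ℕ; zero; suc)
import Data.Nat.Properties as ℕ
open import Data.Product.Base using (Σ; ∃; _×_; _,_; proj₁; proj₂; uncurry)
open import Data.Sum.Base using (_⊎_; inj₁; inj₂)
open import Data.Sum.Properties using (inj₁-injective; inj₂-injective)
open import Data.Vec.Base using ([]; _∷_)
open import Data.Vec.Properties.WithK using ([]=-irrelevant)
open import Data.Empty using (⊥)
open import Level using (0ℓ)
open import Relation.Binary.Construct.Closure.Equivalence using (EqClosure)
open import Relation.Binary.Construct.Closure.ReflexiveTransitive using (Star; ε; _◅_)
open import Relation.Binary.Construct.Closure.Symmetric using (SymClosure; fwd; bwd)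
open import Relation.Binary.Construct.Closure.Transitive as Plus using (TransClosure; [_]; _∷_)
open import Relation.Binary.Core using (Rel)
open import Relation.Binary.Definitions using (Decidable; DecidableEquality; Irrelevant)
open import Relation.Binary.PropositionalEquality.Core using (_≡_; _≢_; refl; sym; trans; cong)
open import Relation.Nullary.Decidable.Core
  using (Dec; yes; no; map′; ¬?; _×-dec_; _⊎-dec_; _→-dec_)
open import Relation.Nullary.Negation.Core using (¬_; contradiction)
import Relation.Unary as U

------------------------------------------------------------------------
-- Finite types

record Enumeration (A : Set) : Set where
  field
    elements : List A
    complete : ∀ x → x List.∈ elements
    unique   : Unique elements

  position : A → Fin (length elements)
  position x = index (complete x)

  position-injective : ∀ {x y} → position x ≡ position y → x ≡ y
  position-injective {x} {y} eq =
    trans (lookup-index (complete x))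
      (trans (cong (lookup elements) eq) (sym (lookup-index (complete y))))

  _≟_ : DecidableEquality A
  x ≟ y = map′ position-injective (cong position) (position x Fin.≟ position y)

  module _ {P : U.Pred A 0ℓ} (P? : U.Decidable P) where

    ∀? : Dec (∀ x → P x)
    ∀? = map′ (λ ps x → All.lookup ps (complete x)) (λ p → All.universal p elements)
              (All.all? P? elements)

    ∃? : Dec (∃ P)
    ∃? = map′ (λ p → let x , _ , px = find p in x , px) (λ (x , px) → lose (complete x) px)
              (Any.any? P? elements)

    count : ℕ
    count = length (filter P? elements)

open Enumeration

enum-⊎ : ∀ {A B} → Enumeration A → Enumeration B → Enumeration (A ⊎ B)
enum-⊎ E F = record
  { elements = map inj₁ (elements E) ++ map inj₂ (elements F)
  ; complete = λ where
      (inj₁ x) → ∈-++⁺ˡ (∈-map⁺ inj₁ (complete E x))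
      (inj₂ y) → ∈-++⁺ʳ _ (∈-map⁺ inj₂ (complete F y))
  ; unique   = Unique.++⁺ (Unique.map⁺ inj₁-injective (unique E))
                          (Unique.map⁺ inj₂-injective (unique F))
                          λ (p , q) → disjoint (∈-map⁻ inj₁ p) (∈-map⁻ inj₂ q)
  }
  where
  disjoint : ∀ {z} → (∃ λ x → x List.∈ elements E × z ≡ inj₁ x) →
             ¬ (∃ λ y → y List.∈ elements F × z ≡ inj₂ y)
  disjoint (_ , _ , refl) (_ , _ , ())

enum-× : ∀ {A B} → Enumeration A → Enumeration B → Enumeration (A × B)
enum-× E F = record
  { elements = cartesianProduct (elements E) (elements F)
  ; complete = λ (x , y) → ∈-cartesianProduct⁺ (complete E x) (complete F y)
  ; unique   = Unique.cartesianProduct⁺ (unique E) (unique F)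
  }

module _ {A : Set} {P : U.Pred A 0ℓ} (P? : U.Decidable P) where

  filterΣ : List A → List (Σ A P)
  filterΣ []       = []
  filterΣ (x ∷ xs) with P? x
  ... | yes px = (x , px) ∷ filterΣ xs
  ... | no  _  = filterΣ xs

  filterΣ-∈ : U.Irrelevant P → ∀ {x xs} (px : P x) → x List.∈ xs → (x , px) List.∈ filterΣ xs
  filterΣ-∈ irr {x} px (here refl) with P? x
  ... | yes px′ = here (cong (x ,_) (irr px px′))
  ... | no ¬px  = contradiction px ¬px
  filterΣ-∈ irr {xs = y ∷ _} px (there x∈xs) with P? y
  ... | yes _ = there (filterΣ-∈ irr px x∈xs)
  ... | no  _ = filterΣ-∈ irr px x∈xs

  filterΣ-≢ : ∀ {x xs} (px : P x) → All (x ≢_) xs → All ((x , px) ≢_) (filterΣ xs)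
  filterΣ-≢ px []       = []
  filterΣ-≢ px (_∷_ {y} x≢y x≢ys) with P? y
  ... | yes _ = (λ eq → x≢y (cong proj₁ eq)) ∷ filterΣ-≢ px x≢ys
  ... | no  _ = filterΣ-≢ px x≢ys

  filterΣ-unique : ∀ {xs} → Unique xs → Unique (filterΣ xs)
  filterΣ-unique []              = []
  filterΣ-unique (_∷_ {x} x≢ xs!) with P? x
  ... | yes px = filterΣ-≢ px x≢ ∷ filterΣ-unique xs!
  ... | no  _  = filterΣ-unique xs!

enum-Σ : ∀ {A} {P : U.Pred A 0ℓ} → Enumeration A → U.Decidable P → U.Irrelevant P →
         Enumeration (Σ A P)
enum-Σ E P? irr = record
  { elements = filterΣ P? (elements E)
  ; complete = λ (x , px) → filterΣ-∈ P? irr px (complete E x)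
  ; unique   = filterΣ-unique P? (unique E)
  }

------------------------------------------------------------------------
-- Deciding reachability in a finite type

module _ {A : Set} {R : Rel A 0ℓ} where

  -- Via ks x y: there is a walk from x to y with all intermediate
  -- points in ks (as in Warshall's algorithm).
  Via : List A → Rel A 0ℓ
  Via []       x y = R x y
  Via (k ∷ ks) x y = Via ks x y ⊎ (Via ks x k × Via ks k y)

  via? : Decidable R → ∀ ks → Decidable (Via ks)
  via? R? []       x y = R? x y
  via? R? (k ∷ ks) x y = via? R? ks x y ⊎-dec (via? R? ks x k ×-dec via? R? ks k y)

  via-sound : ∀ ks {x y} → Via ks x y → TransClosure R x y
  via-sound []       r              = [ r ]
  via-sound (k ∷ ks) (inj₁ p)       = via-sound ks p
  via-sound (k ∷ ks) (inj₂ (p , q)) = via-sound ks p Plus.++ via-sound ks q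

  via-arc : ∀ ks {x y} → R x y → Via ks x y
  via-arc []       r = r
  via-arc (k ∷ ks) r = inj₁ (via-arc ks r)

  via-trans : ∀ ks {x y z} → y List.∈ ks → Via ks x y → Via ks y z → Via ks x z
  via-trans (k ∷ ks) (here refl) p q = inj₂ (into p , out q)
    where
    into : ∀ {x} → Via (k ∷ ks) x k → Via ks x k
    into (inj₁ p)       = p
    into (inj₂ (p , _)) = p
    out : ∀ {z} → Via (k ∷ ks) k z → Via ks k z
    out (inj₁ q)       = q
    out (inj₂ (_ , q)) = q
  via-trans (k ∷ ks) (there i) (inj₁ p)       (inj₁ q)        = inj₁ (via-trans ks i p q)
  via-trans (k ∷ ks) (there i) (inj₁ p)       (inj₂ (q , q′)) = inj₂ (via-trans ks i p q , q′)
  via-trans (k ∷ ks) (there i) (inj₂ (p , p′)) (inj₁ q)       = inj₂ (p , via-trans ks i p′ q)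
  via-trans (k ∷ ks) (there i) (inj₂ (p , _)) (inj₂ (_ , q′)) = inj₂ (p , q′)

  via-complete : ∀ {ks} → (∀ x → x List.∈ ks) → ∀ {x y} → TransClosure R x y → Via ks x y
  via-complete {ks} all [ r ]   = via-arc ks r
  via-complete {ks} all (r ∷ p) = via-trans ks (all _) (via-arc ks r) (via-complete all p)

transClosure? : ∀ {A} {R : Rel A 0ℓ} → Enumeration A → Decidable R → Decidable (TransClosure R)
transClosure? E R? x y =
  map′ (via-sound (elements E)) (via-complete (complete E)) (via? R? (elements E) x y)

module _ {A : Set} {R : Rel A 0ℓ} where

  star-⇐ : ∀ {x y} → x ≡ y ⊎ TransClosure R x y → Star R x y
  star-⇐ (inj₁ refl)    = ε
  star-⇐ (inj₂ [ r ])   = r ◅ ε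
  star-⇐ (inj₂ (r ∷ p)) = r ◅ star-⇐ (inj₂ p)

  star-⇒ : ∀ {x y} → Star R x y → x ≡ y ⊎ TransClosure R x y
  star-⇒ ε       = inj₁ refl
  star-⇒ (r ◅ p) with star-⇒ p
  ... | inj₁ refl = inj₂ [ r ]
  ... | inj₂ q    = inj₂ (r ∷ q)

  symClosure? : Decidable R → Decidable (SymClosure R)
  symClosure? R? x y = map′ (λ { (inj₁ r) → fwd r ; (inj₂ r) → bwd r })
                            (λ { (fwd r) → inj₁ r ; (bwd r) → inj₂ r })
                            (R? x y ⊎-dec R? y x)

eqClosure? : ∀ {A} {R : Rel A 0ℓ} → Enumeration A → Decidable R → Decidable (EqClosure R)
eqClosure? E R? x y =
  map′ star-⇐ star-⇒ (_≟_ E x y ⊎-dec transClosure? E (symClosure? R?) x y)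

------------------------------------------------------------------------
-- Digraphs

-- Irrelevance of _⟶_ says that there are no parallel arcs.
record Digraph : Set₁ where
  infix 4 _⟶_ _⟶?_
  field
    V            : Set
    vertexEnum   : Enumeration V
    _⟶_          : Rel V 0ℓ
    _⟶?_         : Decidable _⟶_
    ⟶-irrelevant : Irrelevant _⟶_
    loopless     : ∀ v → ¬ (v ⟶ v)

  Arc : Set
  Arc = Σ (V × V) (uncurry _⟶_)

  tail head : Arc → V
  tail ((u , _) , _) = u
  head ((_ , v) , _) = v

  arcEnum : Enumeration Arc
  arcEnum = enum-Σ (enum-× vertexEnum vertexEnum) (uncurry _⟶?_) ⟶-irrelevant

  vertices : List V
  vertices = elements vertexEnum

  size : ℕ
  size = length (elements arcEnum)

  outdeg indeg : V → ℕ
  outdeg v = count arcEnum (λ e → _≟_ vertexEnum (tail e) v)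
  indeg  v = count arcEnum (λ e → _≟_ vertexEnum (head e) v)

module _ (D : Digraph) where
  open Digraph D

  Connected : Set
  Connected = ∀ u v → EqClosure _⟶_ u v

  -- Directed cycles: a 2-cycle formed by opposite arcs counts.
  Acyclic : Set
  Acyclic = ∀ v → ¬ TransClosure _⟶_ v v

  IsRoot : V → Set
  IsRoot r = outdeg r ≡ 0 × (∀ v → v ≢ r → outdeg v ≡ 1)

  IsRootedTree : Set
  IsRootedTree = Connected × Acyclic × ∃ IsRoot

  isRootedTree? : Dec IsRootedTree
  isRootedTree? =
    ∀? vertexEnum (λ u → ∀? vertexEnum λ v → eqClosure? vertexEnum _⟶?_ u v)
    ×-dec ∀? vertexEnum (λ v → ¬? (transClosure? vertexEnum _⟶?_ v v))
    ×-dec ∃? vertexEnum λ r →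
      (outdeg r ℕ.≟ 0)
      ×-dec ∀? vertexEnum (λ v → ¬? (_≟_ vertexEnum v r) →-dec (outdeg v ℕ.≟ 1))

------------------------------------------------------------------------
-- Spanning trees

-- The subdigraph with all vertices of D and only the arcs in S, where
-- arcs are identified with their positions in the enumeration of A(D).
spanningSubdigraph : (D : Digraph) → Subset (Digraph.size D) → Digraph
spanningSubdigraph D S = record
  { V            = V
  ; vertexEnum   = vertexEnum
  ; _⟶_          = λ u v → Σ (u ⟶ v) λ a → position arcEnum ((u , v) , a) ∈ S
  ; _⟶?_         = dec
  ; ⟶-irrelevant = irr
  ; loopless     = λ v (a , _) → loopless v a
  }
  where
  open Digraph D

  dec : Decidable (λ u v → Σ (u ⟶ v) λ a → position arcEnum ((u , v) , a) ∈ S)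
  dec u v with u ⟶? v
  ... | no ¬a = no λ (a , _) → ¬a a
  ... | yes a = map′ (a ,_)
                     (λ { (a′ , i) → transport (⟶-irrelevant a′ a) i })
                     (position arcEnum ((u , v) , a) ∈? S)
    where
    transport : ∀ {a′} → a′ ≡ a → position arcEnum ((u , v) , a′) ∈ S →
                position arcEnum ((u , v) , a) ∈ S
    transport refl i = i

  irr : Irrelevant (λ u v → Σ (u ⟶ v) λ a → position arcEnum ((u , v) , a) ∈ S)
  irr (a , i) (b , j) with ⟶-irrelevant a b
  ... | refl = cong (a ,_) ([]=-irrelevant i j)

IsSpanningTree : (D : Digraph) → Subset (Digraph.size D) → Set
IsSpanningTree D S = IsRootedTree (spanningSubdigraph D S)

isSpanningTree? : (D : Digraph) → U.Decidable (IsSpanningTree D)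
isSpanningTree? D S = isRootedTree? (spanningSubdigraph D S)

subsets : ∀ n → List (Subset n)
subsets zero    = [] ∷ []
subsets (suc n) = map (outside ∷_) (subsets n) ++ map (inside ∷_) (subsets n)

t : Digraph → ℕ
t D = length (filter (isSpanningTree? D) (subsets (Digraph.size D)))

------------------------------------------------------------------------
-- The middle digraph

module _ (D : Digraph) where
  open Digraph D

  MiddleArc : Rel (V ⊎ Arc) 0ℓ
  MiddleArc (inj₁ _) (inj₁ _) = ⊥
  MiddleArc (inj₁ v) (inj₂ e) = tail e ≡ v
  MiddleArc (inj₂ e) (inj₁ v) = head e ≡ v
  MiddleArc (inj₂ e) (inj₂ f) = head e ≡ tail f

  M : Digraph
  M = record
    { V            = V ⊎ Arc
    ; vertexEnum   = enum-⊎ vertexEnum arcEnum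
    ; _⟶_          = MiddleArc
    ; _⟶?_         = dec
    ; ⟶-irrelevant = λ {x} {y} → irr x y
    ; loopless     = λ { (inj₁ _) () ; (inj₂ ((u , v) , a)) v≡u → noLoop a v≡u }
    }
    where
    dec : Decidable MiddleArc
    dec (inj₁ _) (inj₁ _) = no λ ()
    dec (inj₁ v) (inj₂ e) = _≟_ vertexEnum (tail e) v
    dec (inj₂ e) (inj₁ v) = _≟_ vertexEnum (head e) v
    dec (inj₂ e) (inj₂ f) = _≟_ vertexEnum (head e) (tail f)

    uip : ∀ {u v : V} (p q : u ≡ v) → p ≡ q
    uip = Decidable⇒UIP.≡-irrelevant (_≟_ vertexEnum)

    irr : ∀ x y (p q : MiddleArc x y) → p ≡ q
    irr (inj₁ _) (inj₁ _) ()
    irr (inj₁ _) (inj₂ _) = uip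
    irr (inj₂ _) (inj₁ _) = uip
    irr (inj₂ _) (inj₂ _) = uip

    noLoop : ∀ {u v} → u ⟶ v → ¬ (v ≡ u)
    noLoop a refl = loopless _ a

{-# OPTIONS --safe #-}

-- A spanning tree is the same thing as a parent function: one root has no
-- parent, and every other vertex has one and reaches the root.  In M(D) an arc
-- e = (u , v) chooses its parent from {v} ∪ out(v), while v chooses from
-- out(v).  Merging e into v loses only the choice made by e: if the path from
-- e passes through v, keep both choices, otherwise exchange those of e and v.
-- This is a bijection from the trees before the merge to the pairs of a tree
-- after the merge and an arbitrary choice for e, of which there are 1 + d(v).
-- Once all arcs are merged into their heads, the tree lives on D.

module Submission where

open import Defs
open import Data.Bool.Base using (true; false)
open import Data.Fin.Base using (Fin; zero; suc)
open import Data.Fin.Permutation using (↔⇒≡)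
open import Data.Fin.Properties using (*↔×)
open import Data.Fin.Subset using (Subset; inside; outside) renaming (_∈_ to _∈ₛ_)
open import Data.Fin.Subset.Properties using (⊆-antisym)
open import Data.List.Base using (List; []; _∷_; map; filter; length; lookup)
open import Data.List.Membership.Propositional using (_∈_)
open import Data.List.Membership.Propositional.Properties
  using (∈-filter⁺; ∈-filter⁻; ∈-++⁺ˡ; ∈-++⁺ʳ; ∈-map⁺; ∈-map⁻; ∈-lookup)
open import Data.List.Properties using (length-map; filter-accept; filter-reject)
open import Data.List.Relation.Unary.All as All using (All; []; _∷_)
open import Data.List.Relation.Unary.AllPairs using ([]; _∷_)
open import Data.List.Relation.Unary.Any using (here; there; index)
open import Data.List.Relation.Unary.Any.Properties using (lookup-index)
open import Data.List.Relation.Unary.Unique.Propositional using (Unique)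
import Data.List.Relation.Unary.Unique.Propositional.Properties as Unique
open import Data.Maybe.Base as Maybe using (Maybe; just; nothing)
open import Data.Maybe.Properties using (just-injective; ≡-dec; map-∘; map-id; map-cong)
open import Data.Nat.Base using (ℕ; zero; suc; _+_; _*_; _^_)
open import Data.Nat.ListAction using (product)
open import Data.Nat.Properties using (*-assoc; *-identityˡ; *-commutativeSemigroup)
open import Algebra.Properties.CommutativeSemigroup *-commutativeSemigroup using (x∙yz≈y∙xz)
open import Data.Product.Base using (Σ; ∃; _×_; _,_; proj₁; proj₂)
open import Data.Product.Function.NonDependent.Setoid using (_×-inverse_)
open import Data.Product.Relation.Binary.Pointwise.NonDependent using (_×ₛ_; Pointwise-≡↔≡)
open import Data.Sum.Base using (_⊎_; inj₁; inj₂)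
open import Data.Sum.Properties using (inj₂-injective)
open import Data.Vec.Base as Vec using ([]; _∷_; tabulate)
open import Data.Vec.Properties
  using (∷-injectiveʳ; lookup∘tabulate; []=⇒lookup; lookup⇒[]=; tabulate-cong)
open import Function.Base using (_∘_; id)
open import Function.Bundles using (Inverse; _⇔_; mk⇔; Equivalence)
import Function.Construct.Composition as Composition
import Function.Construct.Identity as Identity
import Function.Construct.Symmetry as Symmetry
open import Level using (0ℓ)
open import Relation.Binary.Bundles using (Setoid)
open import Relation.Binary.Construct.Closure.Equivalence using (EqClosure)
open import Relation.Binary.Construct.Closure.ReflexiveTransitive as Star using (Star; ε; _◅_; _◅◅_)
open import Relation.Binary.Construct.Closure.Symmetric using (fwd; bwd)
open import Relation.Binary.Construct.Closure.Transitive using (TransClosure; [_]; _∷_)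
import Relation.Binary.Construct.On as On
open import Relation.Binary.Core using (Rel)
open import Relation.Binary.Definitions using (Decidable; DecidableEquality)
open import Relation.Binary.PropositionalEquality
open import Relation.Nullary.Decidable.Core using (Dec; yes; no; does; map′; _⊎-dec_)
open import Relation.Nullary.Negation.Core using (¬_; contradiction)
import Relation.Unary as U

open Enumeration

-- Trees as parent functions

module _ {N : Set} where

  Step : (N → Maybe N) → Rel N 0ℓ
  Step h x y = h x ≡ just y

  -- Steps are deterministic and `r` has none, so acyclicity and uniqueness of the root follow, and
  -- every other vertex has a parent because its path to `r` is nonempty.
  TreeAt : (N → Maybe N) → N → Set
  TreeAt h r = h r ≡ nothing × ∀ x → Star (Step h) x r

  Tree : (N → Maybe N) → Set
  Tree h = ∃ (TreeAt h)

  Star-resp : ∀ {h k : N → Maybe N} → h ≗ k → ∀ {x y} → Star (Step h) x y → Star (Step k) x y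
  Star-resp h≗k ε = ε
  Star-resp h≗k (s ◅ p) = trans (sym (h≗k _)) s ◅ Star-resp h≗k p

  Tree-resp : ∀ {h k : N → Maybe N} → h ≗ k → Tree h → Tree k
  Tree-resp h≗k (r , hr , reach) = r , trans (sym (h≗k r)) hr , λ x → Star-resp h≗k (reach x)

  -- Induction on the path from `x` to the root. By determinism it runs along the supposed cycle.
  -- Each round moves the base point of the cycle one vertex on, until the root would need a parent.
  acyclic : ∀ {h : N → Maybe N} {r x y} → h r ≡ nothing → Star (Step h) x r →
            Step h x y → ¬ Star (Step h) y x
  acyclic hr ε s _ = contradiction (trans (sym hr) s) λ ()
  acyclic hr (s′ ◅ p) s q with just-injective (trans (sym s′) s)
  acyclic hr (s′ ◅ p) s ε        | refl = acyclic hr p s ε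
  acyclic hr (s′ ◅ p) s (s″ ◅ q) | refl = acyclic hr p s″ (q ◅◅ (s ◅ ε))

  asymmetric : ∀ {h : N → Maybe N} {r x y} → h r ≡ nothing → Star (Step h) x r →
               x ≢ y → Star (Step h) x y → ¬ Star (Step h) y x
  asymmetric hr p x≢y ε       q = x≢y refl
  asymmetric hr p x≢y (s ◅ t) q = acyclic hr p s (t ◅◅ q)

-- Merging one vertex into another

module _ {N : Set} (_≟_ : DecidableEquality N) (a b : N) where

  -- `N` does not shrink: once parents are redirected, `a` remains as a vertex that is nobody's
  -- parent, and its own parent records the choice left over by the merge.
  merge : N → N
  merge x with x ≟ a
  ... | yes _ = b
  ... | no  _ = x

  swap : ∀ {B : Set} → (N → B) → N → B
  swap f x with x ≟ a | x ≟ b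
  ... | yes _ | _     = f b
  ... | no  _ | yes _ = f a
  ... | no  _ | no  _ = f x

  merge-≡ : merge a ≡ b
  merge-≡ with a ≟ a
  ... | yes _ = refl
  ... | no a≢a = contradiction refl a≢a

  merge-≢ : ∀ {x} → x ≢ a → merge x ≡ x
  merge-≢ {x} x≢a with x ≟ a
  ... | yes x≡a = contradiction x≡a x≢a
  ... | no  _ = refl

  swap-a : ∀ {B : Set} (f : N → B) → swap f a ≡ f b
  swap-a f with a ≟ a
  ... | yes _ = refl
  ... | no a≢a = contradiction refl a≢a

  swap-≢ : ∀ {B : Set} (f : N → B) {x} → x ≢ a → x ≢ b → swap f x ≡ f x
  swap-≢ f {x} x≢a x≢b with x ≟ a | x ≟ b
  ... | yes x≡a | _       = contradiction x≡a x≢a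
  ... | no  _   | yes x≡b = contradiction x≡b x≢b
  ... | no  _   | no  _   = refl

  swap-cong : ∀ {B : Set} {f g : N → B} → f ≗ g → swap f ≗ swap g
  swap-cong f≗g x with x ≟ a | x ≟ b
  ... | yes _ | _     = f≗g b
  ... | no  _ | yes _ = f≗g a
  ... | no  _ | no  _ = f≗g x

  swap-∘ : ∀ {B C : Set} (g : B → C) (f : N → B) → g ∘ swap f ≗ swap (g ∘ f)
  swap-∘ g f x with x ≟ a | x ≟ b
  ... | yes _ | _     = refl
  ... | no  _ | yes _ = refl
  ... | no  _ | no  _ = refl

  module _ (a≢b : a ≢ b) where

    swap-b : ∀ {B : Set} (f : N → B) → swap f b ≡ f a
    swap-b f with b ≟ a | b ≟ b
    ... | yes b≡a | _     = contradiction (sym b≡a) a≢b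
    ... | no  _   | yes _ = refl
    ... | no  _   | no b≢b = contradiction refl b≢b

    swap-involutive : ∀ {B : Set} (f : N → B) → swap (swap f) ≗ f
    swap-involutive f x with x ≟ a | x ≟ b
    ... | yes refl | _     = swap-b f
    ... | no  _ | yes refl = swap-a f
    ... | no x≢a  | no x≢b = swap-≢ f x≢a x≢b

    -- Paths are deterministic, so a returning to itself first would never meet b.  Hence
    -- the condition depends only on the parent of a and on those of the vertices other
    -- than a and b, also when h has cycles: merging and unmerging can both test it.
    Meets : (N → Maybe N) → Set
    Meets h = Star (Step h) a b

    module _ (h : N → Maybe N) where

      private
        h′ k k′ : N → Maybe N
        h′ = Maybe.map merge ∘ h
        k  = swap h
        k′ = Maybe.map merge ∘ k

      step-merge : ∀ {u : Maybe N} {z} → u ≡ just z → Maybe.map merge u ≡ just (merge z)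
      step-merge = cong (Maybe.map merge)

      merge-step : ∀ {x y} → Step h′ x y → ∃ λ z → Step h x z × merge z ≡ y
      merge-step {x} s with h x
      merge-step refl | just z = z , refl , refl

      merge-step-≢a : ∀ {x y} → Step h′ x y → y ≢ a
      merge-step-≢a s refl with merge-step s
      ... | z , _ , mz with z ≟ a
      ... | yes _ = a≢b (sym mz)
      ... | no z≢a = z≢a mz

      k-a : ∀ {y} → Step h b y → Step k a y
      k-a = trans (swap-a h)

      k-b : ∀ {y} → Step h a y → Step k b y
      k-b = trans (swap-b h)

      k-≢ : ∀ {x y} → x ≢ a → x ≢ b → Step h x y → Step k x y
      k-≢ x≢a x≢b = trans (swap-≢ h x≢a x≢b)

      nothing⁻ : ∀ {x} → h′ x ≡ nothing → h x ≡ nothing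
      nothing⁻ {x} h′x with h x
      ... | nothing = refl

      -- The root is kept. A path entering `a` now continues from `b`, so the point is that `b`
      -- still reaches the root: its path cannot pass through `a`, since `a` leads back to `b`.
      merge⁺-meets : Meets h → Tree h → Tree h′
      merge⁺-meets a⇝b (r , hr , reach) = r , cong (Maybe.map merge) hr , λ x → all (reach x)
        where
        -- Either some step enters `a`, or no step is redirected and the path survives.
        avoid : ∀ {x} → Star (Step h) x r → Star (Step h) x a ⊎ Star (Step h′) x r
        avoid ε = inj₂ ε
        avoid (_◅_ {j = z} s p) with z ≟ a | avoid p
        ... | yes refl | _      = inj₁ (s ◅ ε)
        ... | no _     | inj₁ q = inj₁ (s ◅ q)
        ... | no z≢a   | inj₂ q = inj₂ (trans (step-merge s) (cong just (merge-≢ z≢a)) ◅ q)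

        b⇝r : Star (Step h′) b r
        b⇝r with avoid (reach b)
        ... | inj₁ q = contradiction q (asymmetric hr (reach a) a≢b a⇝b)
        ... | inj₂ q = q

        all : ∀ {x} → Star (Step h) x r → Star (Step h′) x r
        all ε = ε
        all (_◅_ {j = z} s p) with z ≟ a
        ... | yes refl = trans (step-merge s) (cong just merge-≡) ◅ b⇝r
        ... | no z≢a   = trans (step-merge s) (cong just (merge-≢ z≢a)) ◅ all p

      -- A step redirected from `a` to `b` is restored by inserting the path of `h` from `a` to `b`.
      merge⁻-meets : Meets h → Tree h′ → Tree h
      merge⁻-meets a⇝b (r , h′r , reach) = r , nothing⁻ h′r , λ x → all (reach x)
        where
        all : ∀ {x} → Star (Step h′) x r → Star (Step h) x r
        all ε = ε
        all (s ◅ p) with merge-step s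
        ... | z , s′ , mz≡ with z ≟ a
        all (s ◅ p) | _ , s′ , refl | yes refl = s′ ◅ a⇝b ◅◅ all p
        all (s ◅ p) | _ , s′ , refl | no _     = s′ ◅ all p

      -- After the swap `b` carries the parent of `a` and so acts as the merged `a`; a root at `a`
      -- moves to `b`. First `b` reaches the root along the old path of `a`, which avoids `b`. Other
      -- paths may then be continued from `b`, and `a` follows the old path of `b`.
      merge⁺-misses : ¬ Meets h → Tree h → Tree k′
      merge⁺-misses a⇝̸b (r , hr , reach) = merge r , root , all
        where
        r≢b : r ≢ b
        r≢b refl = a⇝̸b (reach a)

        root : k′ (merge r) ≡ nothing
        root with r ≟ a
        ... | yes refl = cong (Maybe.map merge) (trans (swap-b h) hr)
        ... | no r≢a   = cong (Maybe.map merge) (trans (swap-≢ h r≢a r≢b) hr)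

        -- The first argument tells how to go on from `b`. It receives the path that led to `b`,
        -- which lets a path starting at `a` refute this case.
        lift : ∀ {y} → (Star (Step h) y b → Star (Step k′) b (merge r)) →
               Star (Step h) y r → Star (Step k′) (merge y) (merge r)
        lift atb ε = ε
        lift {y} atb (s ◅ p) with y ≟ a | y ≟ b
        ... | yes refl | _        = step-merge (k-b s) ◅ lift (atb ∘ (s ◅_)) p
        ... | no _     | yes refl = atb ε
        ... | no y≢a   | no y≢b   = step-merge (k-≢ y≢a y≢b s) ◅ lift (atb ∘ (s ◅_)) p

        b⇝r : Star (Step k′) b (merge r)
        b⇝r = subst (λ z → Star (Step k′) z (merge r)) merge-≡
                    (lift (λ a⇝b → contradiction a⇝b a⇝̸b) (reach a))

        all : ∀ x → Star (Step k′) x (merge r)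
        all x with x ≟ a
        ... | no x≢a = subst (λ z → Star (Step k′) z (merge r)) (merge-≢ x≢a)
                             (lift (λ _ → b⇝r) (reach x))
        ... | yes refl with reach b
        ...   | ε     = contradiction refl r≢b
        ...   | s ◅ p = step-merge (k-a s) ◅ lift (λ _ → b⇝r) p

      -- First `a`, which inherits the parent of `b`, follows the old path of `b`, and that never
      -- returns to `b`. Then `b` follows the old path of `a`, which misses `b`. All other paths are
      -- continued at `a` or `b`.
      merge⁻-misses : ¬ Meets h → Tree h′ → Tree k
      merge⁻-misses a⇝̸b (r , h′r , reach) = r′ , root , all
        where
        hr : h r ≡ nothing
        hr = nothing⁻ h′r

        -- Nothing steps into `a` in `h′`, so `a` cannot be the root that `b` reaches.
        into-a : ∀ {x} → Star (Step h′) x a → x ≡ a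
        into-a ε = refl
        into-a (s ◅ p) = contradiction (into-a p) (merge-step-≢a s)

        r≢a : r ≢ a
        r≢a refl = a≢b (sym (into-a (reach b)))

        -- If `b` was the root, the swap hands its missing parent to `a`.
        r′ : N
        r′ with r ≟ b
        ... | yes _ = a
        ... | no  _ = r

        r≢b⇒r≡r′ : r ≢ b → r ≡ r′
        r≢b⇒r≡r′ r≢b with r ≟ b
        ... | yes r≡b = contradiction r≡b r≢b
        ... | no  _   = refl

        root : k r′ ≡ nothing
        root with r ≟ b
        ... | yes refl = trans (swap-a h) hr
        ... | no r≢b   = trans (swap-≢ h r≢a r≢b) hr

        -- A path that never reaches `b` has no redirected step, since those end in `b`, and uses no
        -- swapped parent; so `k` has it too.
        avoidB : ∀ {y} → y ≢ a → ¬ Star (Step h′) y b → Star (Step h′) y r → Star (Step k) y r′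
        avoidB y≢a y⇝̸b ε = subst (Star (Step k) r) (r≢b⇒r≡r′ λ { refl → y⇝̸b ε }) ε
        avoidB y≢a y⇝̸b (s ◅ p) with merge-step s
        ... | z , s′ , mz≡ with z ≟ a
        avoidB y≢a y⇝̸b (s ◅ p) | z , s′ , refl | yes refl = contradiction (s ◅ ε) y⇝̸b
        avoidB y≢a y⇝̸b (s ◅ p) | z , s′ , refl | no z≢a =
          k-≢ y≢a (λ { refl → y⇝̸b ε }) s′ ◅ avoidB z≢a (y⇝̸b ∘ (s ◅_)) p

        a⇝r′ : Star (Step k) a r′
        a⇝r′ with r ≟ b | reach b
        ... | yes _  | _ = ε
        ... | no r≢b | ε = contradiction refl r≢b
        ... | no r≢b | s ◅ p with merge-step s | acyclic h′r (reach b) s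
        ...   | z , s′ , mz≡ | y⇝̸b with z ≟ a
        a⇝r′ | no r≢b | s ◅ p | z , s′ , refl | y⇝̸b | yes refl = contradiction ε y⇝̸b
        a⇝r′ | no r≢b | s ◅ p | z , s′ , refl | y⇝̸b | no z≢a =
          k-a s′ ◅ subst (Star (Step k) z) (sym (r≢b⇒r≡r′ r≢b)) (avoidB z≢a y⇝̸b p)

        lift : ∀ {y} → y ≢ a → (Star (Step h) y b → Star (Step k) b r′) →
               Star (Step h′) y r → Star (Step k) y r′
        lift {y} y≢a atb p with y ≟ b
        ... | yes refl = atb ε
        lift y≢a atb ε | no y≢b = subst (Star (Step k) r) (r≢b⇒r≡r′ y≢b) ε
        lift y≢a atb (s ◅ p) | no y≢b with merge-step s
        ... | z , s′ , mz≡ with z ≟ a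
        -- In `h′` this step was redirected to `b`; in `k` it still enters `a`, whose path is
        -- already known.
        lift y≢a atb (s ◅ p) | no y≢b | z , s′ , refl | yes refl = k-≢ y≢a y≢b s′ ◅ a⇝r′
        lift y≢a atb (s ◅ p) | no y≢b | z , s′ , refl | no z≢a =
          k-≢ y≢a y≢b s′ ◅ lift z≢a (atb ∘ (s′ ◅_)) p

        b⇝r′ : Star (Step k) b r′
        b⇝r′ with reach a
        ... | ε = contradiction refl r≢a
        ... | s ◅ p with merge-step s
        ...   | z , s′ , mz≡ with z ≟ a
        b⇝r′ | s ◅ p | z , s′ , refl | yes refl = k-b s′ ◅ a⇝r′
        b⇝r′ | s ◅ p | z , s′ , refl | no z≢a =
          k-b s′ ◅ lift z≢a (λ z⇝b → contradiction (s′ ◅ z⇝b) a⇝̸b) p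

        all : ∀ x → Star (Step k) x r′
        all x with x ≟ a
        ... | yes refl = a⇝r′
        ... | no x≢a   = lift x≢a (λ _ → b⇝r′) (reach x)

      -- Needed for swapping twice to undo itself: the swapped function must fail the test again. In
      -- `k` the vertex `a` leaves by the old step of `b`, so meeting `b` would close a cycle of `h`
      -- through `b`.
      misses⁺ : ¬ Meets h → Tree h → ¬ Meets k
      misses⁺ a⇝̸b (r , hr , reach) a⇝b with back a⇝b
        where
        back : ∀ {y} → Star (Step k) y b → (∃ λ z → Step h b z × Star (Step h) z b) ⊎ Star (Step h) y b
        back ε = inj₂ ε
        back {y} (s ◅ p) with back p | y ≟ a | y ≟ b
        ... | inj₁ c | _ | _ = inj₁ c
        ... | inj₂ q | yes refl | _ = inj₁ (_ , s , q)
        ... | inj₂ q | no _     | yes refl = inj₂ ε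
        ... | inj₂ q | no _     | no _ = inj₂ (s ◅ q)
      ... | inj₁ (_ , s , q) = acyclic hr (reach b) s q
      ... | inj₂ q = a⇝̸b q

      -- The same cycle argument on the merged side, where the tree is `h′`: the path is projected
      -- by `merge` and cut at its first return to `a` or `b`, both of which project to `b`.
      misses⁻ : Tree h′ → ¬ Meets k
      misses⁻ (r , h′r , reach) a⇝b = go a⇝b refl
        where
        back : ∀ {y} → Star (Step k) y b → Star (Step h′) (merge y) b
        back ε = subst (λ z → Star (Step h′) z b) (sym (merge-≢ (a≢b ∘ sym))) ε
        back {y} (s ◅ p) with y ≟ a | y ≟ b
        ... | yes refl | _        = ε
        ... | no _     | yes refl = ε
        ... | no _     | no _     = step-merge s ◅ back p

        go : ∀ {y} → Star (Step k) y b → y ≢ a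
        go ε y≡a = a≢b (sym y≡a)
        go (s ◅ p) refl = acyclic h′r (reach b) (step-merge (trans (sym (swap-a h)) s)) (back p)

-- Bijections between finite setoids

-- Only first components are compared, so different proofs of `P` do not multiply the elements.
restrict : (S : Setoid 0ℓ 0ℓ) → (Setoid.Carrier S → Set) → Setoid 0ℓ 0ℓ
restrict S P = On.setoid {B = Σ (Setoid.Carrier S) P} S proj₁

mkInverse : ∀ {S T : Setoid 0ℓ 0ℓ} (let open Setoid)
  (f : Carrier S → Carrier T) (g : Carrier T → Carrier S) →
  (∀ {x y} → _≈_ S x y → _≈_ T (f x) (f y)) → (∀ {x y} → _≈_ T x y → _≈_ S (g x) (g y)) →
  (∀ y → _≈_ T (f (g y)) y) → (∀ x → _≈_ S (g (f x)) x) → Inverse S T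
mkInverse {S} {T} f g f-cong g-cong fg gf = record
  { to = f ; from = g ; to-cong = f-cong ; from-cong = g-cong
  ; inverse = (λ {y} eq → Setoid.trans T (f-cong eq) (fg y))
            , (λ {x} eq → Setoid.trans S (g-cong eq) (gf x))
  }

infixr 9 _⨾_
_⨾_ : ∀ {S T U : Setoid 0ℓ 0ℓ} → Inverse S T → Inverse T U → Inverse S U
_⨾_ = Composition.inverse

lookup-injective : ∀ {A : Set} {xs : List A} → Unique xs →
                   ∀ i j → lookup xs i ≡ lookup xs j → i ≡ j
lookup-injective (x≢ ∷ _)   zero    zero    eq = refl
lookup-injective (x≢ ∷ _)   zero    (suc j) eq = contradiction eq (All.lookup x≢ (∈-lookup j))
lookup-injective (x≢ ∷ _)   (suc i) zero    eq = contradiction (sym eq) (All.lookup x≢ (∈-lookup i))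
lookup-injective (_ ∷ xs!)  (suc i) (suc j) eq = cong suc (lookup-injective xs! i j eq)

list↔ : ∀ {A : Set} {P : A → Set} {xs : List A} → Unique xs → (∀ {x} → x ∈ xs ⇔ P x) →
        Inverse (setoid (Fin (length xs))) (restrict (setoid A) P)
list↔ {A} {P} {xs} xs! ∈⇔P = mkInverse
  (λ i → lookup xs i , Equivalence.to ∈⇔P (∈-lookup i))
  (index ∘ mem)
  (cong (lookup xs))
  (λ {x} {y} eq → lookup-injective xs! _ _
    (trans (sym (lookup-index (mem x))) (trans eq (lookup-index (mem y)))))
  (λ y → sym (lookup-index (mem y)))
  (λ i → lookup-injective xs! _ _
    (sym (lookup-index (mem (lookup xs i , Equivalence.to ∈⇔P (∈-lookup i))))))
  where
  mem : ((x , _) : Σ A P) → x ∈ xs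
  mem (x , px) = Equivalence.from ∈⇔P px

filter↔ : ∀ {A : Set} {P : A → Set} (P? : U.Decidable P) {xs : List A} →
          Unique xs → (∀ x → x ∈ xs) →
          Inverse (setoid (Fin (length (filter P? xs)))) (restrict (setoid A) P)
filter↔ P? {xs} xs! all = list↔ (Unique.filter⁺ P? xs!)
  (mk⇔ (proj₂ ∘ ∈-filter⁻ P? {xs = xs}) (∈-filter⁺ P? (all _)))

subsets-complete : ∀ {n} (S : Subset n) → S ∈ subsets n
subsets-complete []            = here refl
subsets-complete (false ∷ S) = ∈-++⁺ˡ (∈-map⁺ (outside ∷_) (subsets-complete S))
subsets-complete (true ∷ S)  = ∈-++⁺ʳ _ (∈-map⁺ (inside ∷_) (subsets-complete S))

subsets-unique : ∀ n → Unique (subsets n)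
subsets-unique zero    = [] ∷ []
subsets-unique (suc n) =
  Unique.++⁺ (Unique.map⁺ ∷-injectiveʳ (subsets-unique n))
             (Unique.map⁺ ∷-injectiveʳ (subsets-unique n))
             λ (p , q) → disjoint (∈-map⁻ (outside ∷_) p) (∈-map⁻ (inside ∷_) q)
  where
  disjoint : ∀ {z} → (∃ λ S → S ∈ subsets n × z ≡ outside ∷ S) →
             ¬ (∃ λ S → S ∈ subsets n × z ≡ inside ∷ S)
  disjoint (_ , _ , refl) (_ , _ , ())

star? : ∀ {A : Set} {R : A → A → Set} → Enumeration A → Decidable R → Decidable (Star R)
star? E R? x y = map′ star-⇐ star-⇒ (_≟_ E x y ⊎-dec transClosure? E R? x y)

module _ {A : Set} (E : Enumeration A) {P : A → Set} (P? : U.Decidable P) where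

  count≡0⇒∄ : count E P? ≡ 0 → ∀ x → ¬ P x
  count≡0⇒∄ eq x px with filter P? (elements E) | ∈-filter⁺ P? (complete E x) px
  count≡0⇒∄ () x px | _ ∷ _ | _

  ∄⇒count≡0 : (∀ x → ¬ P x) → count E P? ≡ 0
  ∄⇒count≡0 ¬P with filter P? (elements E) | (λ {x} → ∈-filter⁻ P? {v = x} {xs = elements E})
  ... | []    | _    = refl
  ... | x ∷ _ | mem⇒ = contradiction (proj₂ (mem⇒ (here refl))) (¬P x)

  count≡1⇒∃! : count E P? ≡ 1 → ∃ λ x → P x × (∀ y → P y → y ≡ x)
  count≡1⇒∃! eq with filter P? (elements E) | (λ {x} → ∈-filter⁻ P? {v = x} {xs = elements E})
                   | (λ y → ∈-filter⁺ P? (complete E y))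
  count≡1⇒∃! eq | x ∷ [] | mem⇒ | ⇒mem = x , proj₂ (mem⇒ (here refl)) , λ y py → only (⇒mem y py)
    where
    only : ∀ {y} → y ∈ x ∷ [] → y ≡ x
    only (here eq) = eq

  ∃!⇒count≡1 : ∀ {x} → P x → (∀ y → P y → y ≡ x) → count E P? ≡ 1
  ∃!⇒count≡1 {x} px only with filter P? (elements E)
                     | (λ {x} → ∈-filter⁻ P? {v = x} {xs = elements E})
                     | ∈-filter⁺ P? (complete E x) px | Unique.filter⁺ P? (unique E)
  ... | _ ∷ []    | _    | _ | _ = refl
  ... | y ∷ z ∷ _ | mem⇒ | _ | (y≢z ∷ _) ∷ _ =
    contradiction (trans (only y (proj₂ (mem⇒ (here refl))))
                         (sym (only z (proj₂ (mem⇒ (there (here refl))))))) y≢z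

-- Spanning trees of a digraph

module _ (G : Digraph) where
  open Digraph G

  Along : (V → Maybe V) → Set
  Along f = ∀ {x y} → f x ≡ just y → x ⟶ y

  -- Parents are redirected along ρ, but f still records arcs of G.
  Trees : (V → V) → Setoid 0ℓ 0ℓ
  Trees ρ = restrict (V →-setoid Maybe V) (λ f → Along f × Tree (Maybe.map ρ ∘ f))

  outdeg≡0⇒ : ∀ {v} → outdeg v ≡ 0 → ∀ {y} → ¬ (v ⟶ y)
  outdeg≡0⇒ eq a = count≡0⇒∄ arcEnum _ eq (_ , a) refl

  outdeg≡1⇒ : ∀ {v} → outdeg v ≡ 1 → ∃ λ y → v ⟶ y × (∀ {z} → v ⟶ z → z ≡ y)
  outdeg≡1⇒ eq with count≡1⇒∃! arcEnum _ eq
  ... | ((_ , y) , a) , refl , only = y , a , λ b → cong head (only (_ , b) refl)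

  outdeg≡0⇐ : ∀ {v} → (∀ {y} → ¬ (v ⟶ y)) → outdeg v ≡ 0
  outdeg≡0⇐ ¬a = ∄⇒count≡0 arcEnum _ λ { (_ , a) refl → ¬a a }

  outdeg≡1⇐ : ∀ {v y} → v ⟶ y → (∀ {z} → v ⟶ z → z ≡ y) → outdeg v ≡ 1
  outdeg≡1⇐ a only = ∃!⇒count≡1 arcEnum _ {x = _ , a} refl λ { (_ , b) refl → unique-arc b (only b) }
    where
    unique-arc : ∀ {z} (b : _ ⟶ z) → z ≡ _ → (_ , b) ≡ (_ , a)
    unique-arc b refl = cong (_ ,_) (⟶-irrelevant b a)

module _ (G : Digraph) where
  open Digraph G

  Represents : (V → Maybe V) → Set
  Represents f = ∀ {x y} → x ⟶ y ⇔ f x ≡ just y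

  module _ {f : V → Maybe V} (rep : Represents f) where

    private
      arc⇒ : ∀ {x y} → x ⟶ y → f x ≡ just y
      arc⇒ = Equivalence.to rep
      ⇒arc : ∀ {x y} → f x ≡ just y → x ⟶ y
      ⇒arc = Equivalence.from rep

    rooted⇒tree : IsRootedTree G → Tree f
    rooted⇒tree (conn , _ , r , out-r , _) = r , fr , λ x → reach (conn x r)
      where
      fr : f r ≡ nothing
      fr with f r in eq
      ... | nothing = refl
      ... | just _  = contradiction (⇒arc eq) (outdeg≡0⇒ G out-r)
      -- If an undirected path uses an arc from `y` to `x` backwards, then `x` is the only parent of
      -- `y`, so the directed path from `y` to the root begins with this arc and dropping it leaves
      -- one from `x`.
      back : ∀ {x y} → Step f y x → Star (Step f) y r → Star (Step f) x r
      back s ε = contradiction (trans (sym fr) s) λ ()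
      back s (s′ ◅ p) with just-injective (trans (sym s) s′)
      ... | refl = p
      reach : ∀ {x} → EqClosure _⟶_ x r → Star (Step f) x r
      reach ε = ε
      reach (fwd a ◅ p) = arc⇒ a ◅ reach p
      reach (bwd a ◅ p) = back (arc⇒ a) (reach p)

    tree⇒rooted : Tree f → IsRootedTree G
    tree⇒rooted (r , fr , reach) = conn , acyc , r , out-r , out
      where
      down : ∀ {x} → Star (Step f) x r → EqClosure _⟶_ x r
      down = Star.map (fwd ∘ ⇒arc)
      up : ∀ {x} → Star (Step f) x r → EqClosure _⟶_ r x
      up p = Star.reverse (λ { (fwd a) → bwd a ; (bwd a) → fwd a }) (down p)
      conn : Connected G
      conn u v = down (reach u) ◅◅ up (reach v)
      path : ∀ {x y} → TransClosure _⟶_ x y → Star (Step f) x y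
      path [ a ]   = arc⇒ a ◅ ε
      path (a ∷ p) = arc⇒ a ◅ path p
      acyc : Acyclic G
      acyc v [ a ]   = acyclic fr (reach v) (arc⇒ a) ε
      acyc v (a ∷ p) = acyclic fr (reach v) (arc⇒ a) (path p)
      out-r : outdeg r ≡ 0
      out-r = outdeg≡0⇐ G λ a → contradiction (trans (sym fr) (arc⇒ a)) λ ()
      out : ∀ v → v ≢ r → outdeg v ≡ 1
      out v v≢r with reach v
      ... | ε = contradiction refl v≢r
      ... | s ◅ _ = outdeg≡1⇐ G (⇒arc s) λ b → just-injective (trans (sym (arc⇒ b)) s)

  parent : V → Maybe V
  parent x with ∃? vertexEnum (x ⟶?_)
  ... | yes (y , _) = just y
  ... | no _        = nothing

  -- `parent` takes whichever out-neighbour the search finds; outdegrees of at most one make it the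
  -- only one.
  parent-represents : IsRootedTree G → Represents parent
  parent-represents (_ , _ , r , out-r , out) {x} {y} = mk⇔ to from
    where
    functional : ∀ {y z} → x ⟶ y → x ⟶ z → z ≡ y
    functional a b with _≟_ vertexEnum x r
    ... | yes refl = contradiction a (outdeg≡0⇒ G out-r)
    ... | no x≢r with outdeg≡1⇒ G (out x x≢r)
    ...   | _ , _ , only = trans (only b) (sym (only a))
    to : x ⟶ y → parent x ≡ just y
    to a with ∃? vertexEnum (x ⟶?_)
    ... | yes (_ , b) = cong just (functional a b)
    ... | no ¬b       = contradiction (y , a) ¬b
    from : parent x ≡ just y → x ⟶ y
    from eq with ∃? vertexEnum (x ⟶?_)
    from refl | yes (_ , a) = a

  represents-unique : ∀ {f g} → Represents f → Represents g → f ≗ g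
  represents-unique {f} {g} rf rg x with f x in eq | g x in eq′
  ... | nothing | nothing = refl
  ... | just y  | gx      = trans (sym (Equivalence.to rg (Equivalence.from rf eq))) eq′
  ... | nothing | just y  = trans (sym eq) (Equivalence.to rf (Equivalence.from rg eq′))

module _ (D : Digraph) where
  open Digraph D

  arcSet : (V → Maybe V) → Subset size
  arcSet f = tabulate λ i → let ((u , v) , _) = lookup (elements arcEnum) i in
                            does (≡-dec (_≟_ vertexEnum) (f u) (just v))

  ∈-arcSet : ∀ f {u v} (a : u ⟶ v) → position arcEnum ((u , v) , a) ∈ₛ arcSet f ⇔ f u ≡ just v
  ∈-arcSet f {u} {v} a = mk⇔
    (λ i∈ → to (≡-dec _ (f u) (just v)) (trans (sym here≡) ([]=⇒lookup i∈)))
    (λ eq → lookup⇒[]= _ _ (trans here≡ (from (≡-dec _ (f u) (just v)) eq)))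
    where
    to : ∀ {P : Set} (P? : Dec P) → does P? ≡ true → P
    to (yes p) _ = p
    from : ∀ {P : Set} (P? : Dec P) → P → does P? ≡ true
    from (yes _) _ = refl
    from (no ¬p) p = contradiction p ¬p
    here≡ : Vec.lookup (arcSet f) (position arcEnum ((u , v) , a)) ≡
            does (≡-dec (_≟_ vertexEnum) (f u) (just v))
    here≡ = trans (lookup∘tabulate _ (position arcEnum ((u , v) , a)))
                  (cong (λ ((u , v) , _) → does (≡-dec (_≟_ vertexEnum) (f u) (just v)))
                        (sym (lookup-index (complete arcEnum ((u , v) , a)))))

  arcSet-represents : ∀ {f} → Along D f → Represents (spanningSubdigraph D (arcSet f)) f
  arcSet-represents {f} along = mk⇔
    (λ (a , i) → Equivalence.to (∈-arcSet f a) i)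
    (λ eq → along eq , Equivalence.from (∈-arcSet f (along eq)) eq)

  represented-unique : ∀ {S T f} → Represents (spanningSubdigraph D S) f →
                       Represents (spanningSubdigraph D T) f → S ≡ T
  represented-unique rS rT = ⊆-antisym (sub rS rT) (sub rT rS)
    where
    sub : ∀ {S T f} → Represents (spanningSubdigraph D S) f →
          Represents (spanningSubdigraph D T) f → ∀ {i} → i ∈ₛ S → i ∈ₛ T
    sub {S} {T} rS rT {i} i∈S = subst (_∈ₛ T) pos≡
        (transport (Equivalence.from rT (Equivalence.to rS (proj₂ e , subst (_∈ₛ S) (sym pos≡) i∈S))))
      where
      e : Arc
      e = lookup (elements arcEnum) i
      pos≡ : position arcEnum e ≡ i
      pos≡ = lookup-injective (unique arcEnum) _ _ (sym (lookup-index (complete arcEnum e)))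
      transport : Digraph._⟶_ (spanningSubdigraph D T) (tail e) (head e) → position arcEnum e ∈ₛ T
      transport (a , p) = subst (λ a → position arcEnum (_ , a) ∈ₛ T) (⟶-irrelevant a (proj₂ e)) p

  -- `parent` and `arcSet` are inverse because an arc set and a parent function that represent each
  -- other determine each other.
  spanningTrees↔ : Inverse (setoid (Fin (t D))) (Trees D id)
  spanningTrees↔ =
    filter↔ (isSpanningTree? D) (subsets-unique size) subsets-complete ⨾ mkInverse
      (λ (S , st) → let rep = parent-represents (sub S) st in
        parent (sub S) ,
        along S rep ,
        Tree-resp (λ _ → sym (map-id _)) (rooted⇒tree (sub S) rep st))
      (λ (f , along , tree) → arcSet f , spanning along tree)
      (λ { refl _ → refl })
      (λ f≗g → tabulate-cong λ i → cong (λ z → does (≡-dec (_≟_ vertexEnum) z _)) (f≗g _))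
      (λ (f , along , tree) → represents-unique (sub (arcSet f))
        (parent-represents (sub (arcSet f)) (spanning along tree))
        (arcSet-represents along))
      (λ (S , st) → let rep = parent-represents (sub S) st in
        represented-unique (arcSet-represents (along S rep)) rep)
    where
    sub : Subset size → Digraph
    sub = spanningSubdigraph D
    along : ∀ S {f} → Represents (sub S) f → Along D f
    along S rep eq = proj₁ (Equivalence.from rep eq)
    spanning : ∀ {f} → Along D f → Tree (Maybe.map id ∘ f) → IsSpanningTree D (arcSet f)
    spanning {f} along tree =
      tree⇒rooted (sub (arcSet f)) (arcSet-represents along) (Tree-resp (map-id ∘ f) tree)

-- The merge as a bijection between sets of trees

module _ {N : Set} (E : Enumeration N) {a b : N} (a≢b : a ≢ b) (ρ : N → N) where

  private
    _≟N_ : DecidableEquality N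
    _≟N_ = _≟_ E
    μ : N → N
    μ = merge _≟N_ a b
    ex : (N → Maybe N) → (N → Maybe N)
    ex = swap _≟N_ a b
    re : (N → N) → (N → Maybe N) → (N → Maybe N)
    re ρ f = Maybe.map ρ ∘ f

  Meeting : (N → Maybe N) → Set
  Meeting f = Meets _≟N_ a b a≢b (re ρ f)

  meeting? : U.Decidable Meeting
  meeting? f = star? E (λ x y → ≡-dec _≟N_ (re ρ f x) (just y)) a b

  -- One map serves both directions of the bijection. It swaps the original parents stored in `f`,
  -- while the test follows the parents redirected by `ρ`.
  exchange : (N → Maybe N) → (N → Maybe N)
  exchange f with meeting? f
  ... | yes _ = f
  ... | no  _ = ex f

  exchange-meets : ∀ {f} → Meeting f → exchange f ≡ f
  exchange-meets {f} m with meeting? f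
  ... | yes _ = refl
  ... | no ¬m = contradiction m ¬m

  exchange-misses : ∀ {f} → ¬ Meeting f → exchange f ≡ ex f
  exchange-misses {f} ¬m with meeting? f
  ... | yes m = contradiction m ¬m
  ... | no _  = refl

  re-cong : ∀ {ρ f g} → f ≗ g → re ρ f ≗ re ρ g
  re-cong f≗g x = cong (Maybe.map _) (f≗g x)

  exchange-cong : ∀ {f g} → f ≗ g → exchange f ≗ exchange g
  exchange-cong {f} {g} f≗g with meeting? f | meeting? g
  ... | yes _ | yes _ = f≗g
  ... | no  _ | no  _ = swap-cong _≟N_ a b f≗g
  ... | yes m | no ¬m = contradiction (Star-resp (re-cong f≗g) m) ¬m
  ... | no ¬m | yes m = contradiction (Star-resp (re-cong (sym ∘ f≗g)) m) ¬m

  exchange-involutive : ∀ {f} → (¬ Meeting f → ¬ Meeting (ex f)) → exchange (exchange f) ≗ f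
  exchange-involutive {f} stable with meeting? f
  ... | yes m = λ x → cong (λ g → g x) (exchange-meets m)
  ... | no ¬m = λ x → trans (cong (λ g → g x) (exchange-misses (stable ¬m)))
                            (swap-involutive _≟N_ a b a≢b f x)

  re-∘ : ∀ f → re μ (re ρ f) ≗ re (μ ∘ ρ) f
  re-∘ f x = sym (map-∘ (f x))

  re-ex : ∀ ρ f → re ρ (ex f) ≗ ex (re ρ f)
  re-ex ρ f = swap-∘ _≟N_ a b (Maybe.map ρ) f

  -- `exchange` is its own inverse because a failed test stays failed after the swap, on either side
  -- of the merge. `C` stands for the constraint that parents lie along arcs; it has to survive a
  -- swap only where one takes place.
  merge↔ : (C : (N → Maybe N) → Set) → (∀ {f} → C f → ¬ Meeting f → C (ex f)) →
           Inverse (restrict (N →-setoid Maybe N) (λ f → C f × Tree (re ρ f)))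
                   (restrict (N →-setoid Maybe N) (λ f → C f × Tree (re (μ ∘ ρ) f)))
  merge↔ C C-ex = mkInverse
    (λ (f , c , T) → exchange f , C-exchange c , forth T)
    (λ (f , c , T) → exchange f , C-exchange c , back T)
    exchange-cong exchange-cong
    (λ (f , _ , T) → exchange-involutive λ _ m →
      misses⁻ _≟N_ a b a≢b (re ρ f) (Tree-resp (sym ∘ re-∘ f) T) (Star-resp (re-ex ρ f) m))
    (λ (f , _ , T) → exchange-involutive λ ¬m m →
      misses⁺ _≟N_ a b a≢b (re ρ f) ¬m T (Star-resp (re-ex ρ f) m))
    where
    C-exchange : ∀ {f} → C f → C (exchange f)
    C-exchange {f} c with meeting? f
    ... | yes _ = c
    ... | no ¬m = C-ex c ¬m
    forth : ∀ {f} → Tree (re ρ f) → Tree (re (μ ∘ ρ) (exchange f))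
    forth {f} T with meeting? f
    ... | yes m = Tree-resp (re-∘ f) (merge⁺-meets _≟N_ a b a≢b (re ρ f) m T)
    ... | no ¬m = Tree-resp (λ x → trans (cong (Maybe.map μ) (sym (re-ex ρ f x))) (re-∘ (ex f) x))
                            (merge⁺-misses _≟N_ a b a≢b (re ρ f) ¬m T)
    back : ∀ {f} → Tree (re (μ ∘ ρ) f) → Tree (re ρ (exchange f))
    back {f} T with meeting? f
    ... | yes m = merge⁻-meets _≟N_ a b a≢b (re ρ f) m (Tree-resp (sym ∘ re-∘ f) T)
    ... | no ¬m = Tree-resp (sym ∘ re-ex ρ f)
                            (merge⁻-misses _≟N_ a b a≢b (re ρ f) ¬m (Tree-resp (sym ∘ re-∘ f) T))

-- Choice functions

module _ {A B : Set} (E : Enumeration A) {P : A → B → Set} (default : ∀ x → ∃ (P x)) where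

  -- The values outside xs are not compared; default provides them.
  Choices : List A → Setoid 0ℓ 0ℓ
  Choices xs = record
    { Carrier = Σ (A → B) (λ f → ∀ x → P x (f x))
    ; _≈_ = λ f g → ∀ {x} → x ∈ xs → proj₁ f x ≡ proj₁ g x
    ; isEquivalence = record
      { refl = λ _ → refl ; sym = λ eq i → sym (eq i) ; trans = λ eq eq′ i → trans (eq i) (eq′ i) }
    }

  -- All `Choices xs` share one carrier; `Choices []` serves as a name for it.
  update : ∀ {y b} → P y b → Setoid.Carrier (Choices []) → Setoid.Carrier (Choices [])
  update {y} {b} pb (f , pf) = g , pg
    where
    g : A → B
    g x with _≟_ E x y
    ... | yes _ = b
    ... | no  _ = f x
    pg : ∀ x → P x (g x)
    pg x with _≟_ E x y
    ... | yes refl = pb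
    ... | no  _    = pf x

  update-≡ : ∀ {y b} (pb : P y b) f → proj₁ (update pb f) y ≡ b
  update-≡ {y} pb f with _≟_ E y y
  ... | yes _  = refl
  ... | no y≢y = contradiction refl y≢y

  update-≢ : ∀ {y b} (pb : P y b) f {x} → x ≢ y → proj₁ (update pb f) x ≡ proj₁ f x
  update-≢ {y} pb f {x} x≢y with _≟_ E x y
  ... | yes x≡y = contradiction x≡y x≢y
  ... | no  _   = refl

  choices-∷ : ∀ {y xs} → All (y ≢_) xs →
              Inverse (restrict (setoid B) (P y) ×ₛ Choices xs) (Choices (y ∷ xs))
  choices-∷ {y} {xs} y∉xs = mkInverse
    (λ ((b , pb) , f) → update pb f)
    (λ (f , pf) → (f y , pf y) , f , pf)
    (λ { {(_ , pb) , f} {(_ , pb′) , g} (b≡b′ , f≈g) (here refl) →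
           trans (update-≡ pb f) (trans b≡b′ (sym (update-≡ pb′ g)))
       ; {(_ , pb) , f} {(_ , pb′) , g} (b≡b′ , f≈g) (there i) →
           trans (update-≢ pb f (≢y i)) (trans (f≈g i) (sym (update-≢ pb′ g (≢y i)))) })
    (λ f≈g → f≈g (here refl) , λ i → f≈g (there i))
    (λ { (f , pf) (here refl) → update-≡ (pf y) (f , pf)
       ; (f , pf) (there i) → update-≢ (pf y) (f , pf) (≢y i) })
    (λ ((b , pb) , f) → update-≡ pb f , λ i → update-≢ pb f (≢y i))
    where
    ≢y : ∀ {x} → x ∈ xs → x ≢ y
    ≢y i refl = All.lookup y∉xs i refl

  module _ (k : A → ℕ) (size : ∀ x → Inverse (setoid (Fin (k x))) (restrict (setoid B) (P x))) where

    fin-× : ∀ {m n} → Inverse (setoid (Fin (m * n))) (setoid (Fin m) ×ₛ setoid (Fin n))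
    fin-× {m} {n} = *↔× ⨾ Symmetry.inverse Pointwise-≡↔≡

    choices↔ : ∀ {xs} → Unique xs → Inverse (setoid (Fin (product (map k xs)))) (Choices xs)
    -- Over the empty list all choice functions are equal, matching the empty product 1; `default`
    -- represents the single class.
    choices↔ [] = mkInverse (λ _ → proj₁ ∘ default , proj₂ ∘ default) (λ _ → zero)
      (λ _ ()) (λ _ → refl) (λ _ ()) (λ { zero → refl })
    choices↔ (_∷_ {x} x∉xs xs!) = fin-× ⨾ (size x ×-inverse choices↔ xs!) ⨾ choices-∷ x∉xs

    allChoices↔ : Inverse (setoid (Fin (product (map k (elements E)))))
                          (restrict (A →-setoid B) (λ f → ∀ x → P x (f x)))
    allChoices↔ = choices↔ (unique E) ⨾ mkInverse id id
      (λ eq x → eq (complete E x)) (λ eq {x} _ → eq x)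
      (λ _ _ → refl) (λ _ _ → refl)

-- The middle digraph

module _ (D : Digraph) where
  open Digraph D

  private
    N : Set
    N = Digraph.V (M D)
    _≟V_ : DecidableEquality V
    _≟V_ = _≟_ vertexEnum
    _≟N_ : DecidableEquality N
    _≟N_ = _≟_ (Digraph.vertexEnum (M D))

  redirect : List Arc → N → N
  redirect []       = id
  redirect (e ∷ es) = merge _≟N_ (inj₂ e) (inj₁ (head e)) ∘ redirect es

  target : N → V
  target (inj₁ v) = v
  target (inj₂ e) = head e

  redirect-inj₁ : ∀ es {v} → redirect es (inj₁ v) ≡ inj₁ v
  redirect-inj₁ [] = refl
  redirect-inj₁ (e ∷ es) {v} rewrite redirect-inj₁ es {v} = merge-≢ _≟N_ _ _ λ ()

  -- A merge moves only an arc, and always to a vertex, where later merges leave it; so an arc moves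
  -- at most once.
  redirect-inj₂ : ∀ es e → redirect es (inj₂ e) ≡ inj₂ e ⊎ redirect es (inj₂ e) ≡ inj₁ (head e)
  redirect-inj₂ [] e = inj₁ refl
  redirect-inj₂ (e′ ∷ es) e with redirect es (inj₂ e) | redirect-inj₂ es e
  ... | _ | inj₂ refl = inj₂ (merge-≢ _≟N_ _ _ λ ())
  ... | _ | inj₁ refl with inj₂ e ≟N inj₂ e′
  ...   | yes refl = inj₂ refl
  ...   | no _     = inj₁ refl

  redirect-∈ : ∀ {es e} → e ∈ es → redirect es (inj₂ e) ≡ inj₁ (head e)
  redirect-∈ {e ∷ es} (here refl) with redirect es (inj₂ e) | redirect-inj₂ es e
  ... | _ | inj₁ refl = merge-≡ _≟N_ (inj₂ e) (inj₁ (head e))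
  ... | _ | inj₂ refl = merge-≢ _≟N_ _ _ λ ()
  redirect-∈ {e′ ∷ es} {e} (there i) rewrite redirect-∈ i = merge-≢ _≟N_ _ _ λ ()

  redirect-all : ∀ z → redirect (elements arcEnum) z ≡ inj₁ (target z)
  redirect-all (inj₁ v) = redirect-inj₁ (elements arcEnum)
  redirect-all (inj₂ e) = redirect-∈ (complete arcEnum e)

  redirect↔ : ∀ es → Inverse (Trees (M D) id) (Trees (M D) (redirect es))
  redirect↔ []       = Identity.inverse _
  redirect↔ (e ∷ es) = redirect↔ es ⨾
    merge↔ (Digraph.vertexEnum (M D)) (λ ()) (redirect es) (Along (M D)) along-swap
    where
    -- head e itself is the only possible parent of e that head e cannot have, and a
    -- path from e that misses head e does not begin there.
    along-swap : ∀ {f} → Along (M D) f →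
      ¬ Meeting (Digraph.vertexEnum (M D)) {inj₂ e} {inj₁ (head e)} (λ ()) (redirect es) f →
      Along (M D) (swap _≟N_ (inj₂ e) (inj₁ (head e)) f)
    along-swap {f} al miss {x} {y} eq with x ≟N inj₂ e | x ≟N inj₁ (head e)
    along-swap {f} al miss {x} {y} eq | no _ | no _ = al eq
    along-swap {f} al miss {_} {y} eq | yes refl | _ = fromHead (al eq)
      where
      fromHead : ∀ {y} → MiddleArc D (inj₁ (head e)) y → MiddleArc D (inj₂ e) y
      fromHead {inj₂ _} eq = sym eq
    along-swap {f} al miss {_} {inj₁ v} eq | no _ | yes refl =
      contradiction (trans (cong (Maybe.map (redirect es)) eq)
                           (cong just (trans (redirect-inj₁ es) (cong inj₁ (sym (al eq))))) ◅ ε) miss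
    along-swap {f} al miss {_} {inj₂ g} eq | no _ | yes refl = sym (al eq)

  ArcChoices : Setoid 0ℓ 0ℓ
  ArcChoices = restrict (Arc →-setoid N) (λ ψ → ∀ e → MiddleArc D (inj₂ e) (ψ e))

  -- With every parent redirected to a vertex of `D`, the arcs are leaves. The parents of vertices
  -- form a tree on `D`, since the arc chosen by `v` amounts to its head, and the parents of arcs
  -- are independent choices.
  split↔ : Inverse (Trees (M D) (inj₁ ∘ target)) (Trees D id ×ₛ ArcChoices)
  split↔ = mkInverse
    (λ (f , al , T) → (down f , down-along al , down-tree {f} T) , choice f , choice-along al)
    (λ ((φ , al , T) , ψ , alψ) → up φ ψ , up-along alψ , up-tree al T)
    (λ f≗g → (λ v → cong (Maybe.map target) (f≗g (inj₁ v))) ,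
               λ e → cong (Maybe.fromMaybe _) (f≗g (inj₂ e)))
    (λ { (φ≗ , ψ≗) (inj₁ v) → cong (Maybe._>>= arcTo v) (φ≗ v)
       ; (φ≗ , ψ≗) (inj₂ e) → cong just (ψ≗ e) })
    (λ ((φ , al , T) , ψ , alψ) → down-up {ψ = ψ} al , λ e → refl)
    (λ (f , al , T) → up-down al T)
    where
    down : (N → Maybe N) → V → Maybe V
    down f v = Maybe.map target (f (inj₁ v))

    choice : (N → Maybe N) → Arc → N
    -- The default is an allowed parent of `e`, so `choice-along` holds for every `f` along arcs,
    -- tree or not.
    choice f e = Maybe.fromMaybe (inj₁ (head e)) (f (inj₂ e))

    arcTo : V → V → Maybe N
    arcTo v w with v ⟶? w
    ... | yes a = just (inj₂ ((v , w) , a))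
    ... | no _  = nothing

    up : (V → Maybe V) → (Arc → N) → N → Maybe N
    up φ ψ (inj₁ v) = φ v Maybe.>>= arcTo v
    up φ ψ (inj₂ e) = just (ψ e)

    arcTo-⟶ : ∀ {v w} (a : v ⟶ w) → arcTo v w ≡ just (inj₂ ((v , w) , a))
    arcTo-⟶ {v} {w} a with v ⟶? w
    ... | yes b = cong (λ b → just (inj₂ (_ , b))) (⟶-irrelevant b a)
    ... | no ¬a = contradiction a ¬a

    down-along : ∀ {f} → Along (M D) f → Along D (down f)
    down-along {f} al {v} eq with f (inj₁ v) in fv
    down-along {f} al {v} refl | just (inj₁ _) with () ← al fv
    down-along {f} al {v} refl | just (inj₂ (_ , a)) with refl ← al fv = a

    choice-along : ∀ {f} → Along (M D) f → ∀ e → MiddleArc D (inj₂ e) (choice f e)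
    choice-along {f} al e with f (inj₂ e) in fe
    ... | just _  = al fe
    ... | nothing = refl

    -- Every redirected parent is a vertex, so paths from vertices stay among vertices and no arc
    -- can be the root.
    root-vertex : ∀ {f : N → Maybe N} {v e} →
                  ¬ Star (Step (Maybe.map (inj₁ ∘ target) ∘ f)) (inj₁ v) (inj₂ e)
    root-vertex {f} {v} (s ◅ p) with f (inj₁ v)
    root-vertex {f} (refl ◅ p) | just _ = root-vertex {f} p

    down-tree : ∀ {f} → Tree (Maybe.map (inj₁ ∘ target) ∘ f) → Tree (Maybe.map id ∘ down f)
    down-tree {f} (inj₂ e , _ , reach) = contradiction (reach (inj₁ (head e))) (root-vertex {f})
    down-tree {f} (inj₁ r , fr , reach) = r , dr , λ v → path (reach (inj₁ v))
      where
      dr : Maybe.map id (down f r) ≡ nothing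
      dr with f (inj₁ r)
      ... | nothing = refl
      path : ∀ {v} → Star (Step (Maybe.map (inj₁ ∘ target) ∘ f)) (inj₁ v) (inj₁ r) →
             Star (Step (Maybe.map id ∘ down f)) v r
      path ε = ε
      path {v} (s ◅ p) with f (inj₁ v) in fv
      path {v} (refl ◅ p) | just z = cong (Maybe.map id ∘ Maybe.map target) fv ◅ path p

    up-along : ∀ {φ ψ} → (∀ e → MiddleArc D (inj₂ e) (ψ e)) → Along (M D) (up φ ψ)
    up-along {φ} alψ {inj₁ v} eq with φ v
    ... | just w with v ⟶? w
    up-along {φ} alψ {inj₁ v} refl | just w | yes _ = refl
    up-along alψ {inj₂ e} refl = alψ e

    up-tree : ∀ {φ ψ} → Along D φ → Tree (Maybe.map id ∘ φ) → Tree (Maybe.map (inj₁ ∘ target) ∘ up φ ψ)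
    up-tree {φ} {ψ} al (r , φr , reach) = inj₁ r , ur , λ where
        (inj₁ v) → path (reach v)
        (inj₂ e) → refl ◅ path (reach (target (ψ e)))
      where
      ur : Maybe.map (inj₁ ∘ target) (up φ ψ (inj₁ r)) ≡ nothing
      ur = cong (λ m → Maybe.map (inj₁ ∘ target) (m Maybe.>>= arcTo r)) (trans (sym (map-id (φ r))) φr)
      path : ∀ {v} → Star (Step (Maybe.map id ∘ φ)) v r →
             Star (Step (Maybe.map (inj₁ ∘ target) ∘ up φ ψ)) (inj₁ v) (inj₁ r)
      path ε = ε
      path {v} (_◅_ {j = w} s p) = step ◅ path p
        where
        φv : φ v ≡ just w
        φv = trans (sym (map-id (φ v))) s
        step : Maybe.map (inj₁ ∘ target) (up φ ψ (inj₁ v)) ≡ just (inj₁ w)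
        step rewrite φv | arcTo-⟶ (al φv) = refl

    down-up : ∀ {φ ψ} → Along D φ → down (up φ ψ) ≗ φ
    down-up {φ} al v with φ v in φv
    ... | nothing = refl
    ... | just w rewrite arcTo-⟶ (al φv) = refl

    up-down : ∀ {f} → Along (M D) f → Tree (Maybe.map (inj₁ ∘ target) ∘ f) → up (down f) (choice f) ≗ f
    up-down {f} al T (inj₁ v) with f (inj₁ v) in fv
    ... | nothing = refl
    ... | just (inj₁ _) with () ← al fv
    ... | just (inj₂ (_ , a)) with refl ← al fv = arcTo-⟶ a
    up-down {f} al (inj₂ e′ , _ , reach) (inj₂ e) =
      contradiction (reach (inj₁ (head e′))) (root-vertex {f})
    -- The root is a vertex, so the path from `e` to it is nonempty: `e` has a parent and the
    -- default of `choice` does not arise.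
    up-down {f} al (inj₁ r , _ , reach) (inj₂ e) with reach (inj₂ e)
    ... | s ◅ _ with f (inj₂ e) | s
    ...   | just _  | _  = refl
    ...   | nothing | ()

  -- The extra 1 is the head of `e` itself; the other options are the arcs leaving it.
  arcOptions↔ : ∀ e → Inverse (setoid (Fin (1 + outdeg (head e))))
                              (restrict (setoid N) (MiddleArc D (inj₂ e)))
  arcOptions↔ e = subst
    (λ n → Inverse (setoid (Fin (suc n))) (restrict (setoid N) (MiddleArc D (inj₂ e))))
    (length-map inj₂ outArcs)
    (list↔ options! (mk⇔ to from))
    where
    out? : U.Decidable (λ f → tail f ≡ head e)
    out? f = tail f ≟V head e
    outArcs : List Arc
    outArcs = filter out? (elements arcEnum)
    options! : Unique (inj₁ (head e) ∷ map inj₂ outArcs)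
    options! = All.tabulate (λ i eq → distinct (∈-map⁻ inj₂ i) eq)
             ∷ Unique.map⁺ inj₂-injective (Unique.filter⁺ out? (unique arcEnum))
      where
      distinct : ∀ {z} → (∃ λ f → f ∈ outArcs × z ≡ inj₂ f) → inj₁ (head e) ≢ z
      distinct (_ , _ , refl) ()
    to : ∀ {z} → z ∈ inj₁ (head e) ∷ map inj₂ outArcs → MiddleArc D (inj₂ e) z
    to (here refl) = refl
    to (there i) with ∈-map⁻ inj₂ i
    ... | _ , f∈ , refl = sym (proj₂ (∈-filter⁻ out? {xs = elements arcEnum} f∈))
    from : ∀ {z} → MiddleArc D (inj₂ e) z → z ∈ inj₁ (head e) ∷ map inj₂ outArcs
    from {inj₁ _} refl = here refl
    from {inj₂ f} eq   = there (∈-map⁺ inj₂ (∈-filter⁺ out? (complete arcEnum f) (sym eq)))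

  trees-cong : ∀ {ρ ρ′ : N → N} → ρ ≗ ρ′ → Inverse (Trees (M D) ρ) (Trees (M D) ρ′)
  trees-cong ρ≗ρ′ = mkInverse
    (λ (f , al , T) → f , al , Tree-resp (map-cong ρ≗ρ′ ∘ f) T)
    (λ (f , al , T) → f , al , Tree-resp (map-cong (sym ∘ ρ≗ρ′) ∘ f) T)
    (λ eq → eq) (λ eq → eq) (λ _ _ → refl) (λ _ _ → refl)

  -- The chain encodes trees as parent functions, merges all arcs, splits off their choices and
  -- counts both factors. Equality follows because finite types `Fin` in bijection have equal size.
  t-middle : t (M D) ≡ t D * product (map (λ e → 1 + outdeg (head e)) (elements arcEnum))
  t-middle = ↔⇒≡ (spanningTrees↔ (M D) ⨾
    redirect↔ (elements arcEnum) ⨾ trees-cong redirect-all ⨾ split↔ ⨾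
    (Symmetry.inverse (spanningTrees↔ D) ×-inverse
     Symmetry.inverse (allChoices↔ arcEnum (λ e → inj₁ (head e) , refl) _ arcOptions↔)) ⨾
    Pointwise-≡↔≡ ⨾ Symmetry.inverse *↔×)

-- Grouping a product by fibres

module _ {A B : Set} (E : Enumeration B) (h : A → B) (k : B → ℕ) where

  private
    fibre : B → List A → ℕ
    fibre v es = length (filter (λ e → _≟_ E (h e) v) es)

    fibre-≡ : ∀ e es → fibre (h e) (e ∷ es) ≡ suc (fibre (h e) es)
    fibre-≡ e es = cong length (filter-accept (λ e′ → _≟_ E (h e′) (h e)) refl)

    fibre-≢ : ∀ {e v} es → h e ≢ v → fibre v (e ∷ es) ≡ fibre v es
    fibre-≢ {v = v} es he≢v = cong length (filter-reject (λ e → _≟_ E (h e) v) he≢v)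

  product-without : ∀ {e es vs} → All (h e ≢_) vs →
    map (λ v → k v ^ fibre v (e ∷ es)) vs ≡ map (λ v → k v ^ fibre v es) vs
  product-without []  = refl
  product-without {e} {es} (_∷_ {x = v} he≢v rest) =
    cong₂ _∷_ (cong (k v ^_) (fibre-≢ es he≢v)) (product-without rest)

  -- A new element `e` enlarges only the fibre over `h e`, and by uniqueness that fibre contributes
  -- exactly one factor.
  product-with : ∀ {e es vs} → Unique vs → h e ∈ vs →
    product (map (λ v → k v ^ fibre v (e ∷ es)) vs) ≡
    k (h e) * product (map (λ v → k v ^ fibre v es) vs)
  product-with {e} {es} (he∉vs ∷ _) (here refl) =
    trans (cong₂ (λ m ns → k (h e) ^ m * product ns) (fibre-≡ e es) (product-without he∉vs))
          (*-assoc (k (h e)) _ _)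
  product-with {e} {es} (v∉vs ∷ vs!) (there {x = v} i) =
    trans (cong₂ (λ m p → k v ^ m * p) (fibre-≢ es (λ he≡v → All.lookup v∉vs i (sym he≡v)))
                 (product-with vs! i))
          (x∙yz≈y∙xz (k v ^ fibre v es) (k (h e)) _)

  product-fibres : ∀ es → product (map (k ∘ h) es) ≡ product (map (λ v → k v ^ fibre v es) (elements E))
  product-fibres []       = sym (ones (elements E))
    where
    ones : ∀ vs → product (map (λ v → k v ^ 0) vs) ≡ 1
    ones []       = refl
    ones (_ ∷ vs) = trans (*-identityˡ _) (ones vs)
  product-fibres (e ∷ es) = trans (cong (k (h e) *_) (product-fibres es))
                                  (sym (product-with (unique E) (complete E (h e))))

corollary6 : (D : Digraph) → Connected D →
    t (M D) ≡ t D * product (map (λ v → (1 + Digraph.outdeg D v) ^ Digraph.indeg D v)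
    (Digraph.vertices D))
-- By definition `indeg v` is the size of the fibre of `head` over `v`, so grouping the factors of
-- the arcs by their heads gives the exponents.
corollary6 D _ = trans (t-middle D) (cong (t D *_)
  (product-fibres vertexEnum head (λ v → 1 + outdeg v) (elements arcEnum)))
  where open Digraph D
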